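{- Let $\{a_k\}_{k\ge 0}\in\mathcal{S}_{ - }$. Let $n$ be a positive odd integer and let $p$ be a prime such that $p>n+1$. Then $$\sum_{0<k_1<\cdots<k_{n}<p}\frac{a_{p-k_{n}}}{k_1\cdots k_{n}}\equiv \frac{p(n+1)}{2}\sum_{0<k_1<\cdots<k_{n+1}<p}\frac{a_{p-k_{n+1}}}{k_1\cdots k_{n+1}}\pmod{p^3}.$$
   Context: Let $T$ be the binomial transform, the linear transformation of sequences given by $T(\{a_r\})=\left\{\sum_{k=0}^{r}\binom{r}{k}(-1)^k a_k\right\}$, where $r\ge 0$. It is an involution, so its only eigenvalues are $1$ and $-1$. $\mathcal{S}_{ - }$ denotes the eigenspace of $T$ corresponding to the eigenvalue $-1$, i.e. the set of sequences $\{a_k\}_{k\ge 0}$ satisfying $\sum_{k=0}^{r}\binom{r}{k}(-1)^k a_k=-a_r$ for all integers $r\ge 0$. The sums run over all tuples of integers $k_1<k_2<\cdots$ in the indicated range.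
   Formalization: The sequence is taken rational with a_0,…,a_{p-1} p-integral (denominators prime to p), as the congruence requires: for a_k = F_k/5, p = 5, n = 1 it fails. Terms beyond a_{p-n}, which do not occur in the sums, are also assumed p-integral, without real loss. -}

module Defs where

open import Data.Fin.Base using (toℕ)
open import Data.Integer.Base as ℤ using (+_; -1ℤ)
open import Data.Nat.Base as ℕ using (ℕ; zero; suc; pred; NonZero)
open import Data.Nat.Combinatorics using (_C_)
open import Data.Nat.Divisibility using (_∣_)
open import Data.Product.Base using (∃-syntax; _×_)
open import Data.Rational.Base using (ℚ; 0ℚ; _/_; _+_; _-_; _*_; -_; ↧ₙ_)
open import Data.Rational.Properties using (+-0-commutativeMonoid)
open import Data.Vec.Base using (Vec; []; _∷ʳ_; last; foldr′)
open import Level using (0ℓ)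
open import Relation.Binary.PropositionalEquality.Core using (_≡_)
open import Relation.Nullary.Negation.Core using (¬_)
open import Relation.Unary using (Pred)

open import Algebra.Properties.CommutativeMonoid.Sum +-0-commutativeMonoid
  using (sum-syntax; sum⁺-syntax) public

-- ∑[ i ≤ r ] runs over i : Fin (suc r), i.e. over 0, …, r.
T : (ℕ → ℚ) → (ℕ → ℚ)
T a r = ∑[ i ≤ r ] ((+ (r C toℕ i) ℤ.* (-1ℤ ℤ.^ toℕ i)) / 1 * a (toℕ i))

S₋ : Pred (ℕ → ℚ) 0ℓ
S₋ a = ∀ r → T a r ≡ - a r

-- Sum of f (k₁ ∷ … ∷ kₙ ∷ []) over all 0 < k₁ < ⋯ < kₙ < b.  The outermost sum
-- is over the largest index kₙ = suc i; the remaining ones are then below kₙ.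
sumIncreasing : (n b : ℕ) → (Vec ℕ n → ℚ) → ℚ
sumIncreasing zero    b f = f []
sumIncreasing (suc n) b f =
  ∑[ i < pred b ] sumIncreasing n (suc (toℕ i)) (λ ks → f (ks ∷ʳ suc (toℕ i)))

infixl 7 _÷ℕ_

-- The value at divisor 0 is a dummy: below, all divisors are products of
-- positive integers.
_÷ℕ_ : ℚ → ℕ → ℚ
x ÷ℕ zero  = 0ℚ
x ÷ℕ suc d = x * (+ 1 / suc d)

product : ∀ {n} → Vec ℕ n → ℕ
product = foldr′ ℕ._*_ 1

multiSum : (ℕ → ℚ) → (p n : ℕ) → .{{_ : NonZero n}} → ℚ
multiSum a p (suc m) =
  sumIncreasing (suc m) p (λ ks → a (p ℕ.∸ last ks) ÷ℕ product ks)

-- ↧ₙ x is the denominator of x in lowest terms, so for p prime this says x ∈ ℤ₍ₚ₎.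
Integral : ℕ → ℚ → Set
Integral p x = ¬ (p ∣ ↧ₙ x)

-- Congruence modulo the ideal pᵉ ℤ₍ₚ₎ (rather than pᵉ ℤ, as the sums are fractions).
infix 4 _≡_[mod_^_]

_≡_[mod_^_] : ℚ → ℚ → ℕ → ℕ → Set
x ≡ y [mod p ^ e ] = ∃[ z ] Integral p z × x - y ≡ (+ (p ℕ.^ e) / 1) * z

{-# OPTIONS --safe #-}

-- Write Sₘ for multiSum a p m and R k x for x(x+1)⋯(x+k-1)/k!.  Expanding the products
-- R k x = x/k ∏_{j<k} (1 + x/j) gives
--   F(x) := ∑_{k≤p} a(p-k) R k x = a(p) + ∑_{m≥1} Sₘ xᵐ,
-- since a(0) = 0.  Substituting -a(j) = ∑ᵢ (j choose i) (-1)ⁱ a(i) and using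
-- ∑ⱼ (j choose i) R (p-j) x = (-1)^(p-i) R (p-i) (-p-x), one finds F(-p-x) = F(x) for odd p.
-- Comparing coefficients of xⁿ for odd n,
--   2 Sₙ = p(n+1) Sₙ₊₁ - p² ((n+2 choose 2) Sₙ₊₂ + p z)   with z ∈ ℤ₍ₚ₎,
-- and the same identity at n+2 shows that p divides Sₙ₊₂.
module Submission where

open import Defs
open import Algebra.Bundles using (CommutativeRing)
open import Data.Empty using (⊥-elim)
open import Data.Fin.Base using (toℕ)
open import Data.Fin.Permutation using (reverse)
open import Data.Fin.Properties using (toℕ<n; opposite-prop)
open import Data.Integer.Base as ℤ using (ℤ; +_; -1ℤ)
import Data.Integer.Properties as ℤ
open import Data.Integer.Tactic.RingSolver using () renaming (solve-∀ to solveℤ-∀)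
open import Data.Nat.Base as ℕ using (ℕ; zero; suc; pred; NonZero; _<_; _≤_; _∸_; z≤n; s≤s; s≤s⁻¹)
open import Data.Nat.Combinatorics using (_C_; k>n⇒nCk≡0; nCk+nC[k+1]≡[n+1]C[k+1])
import Data.Nat.Coprimality as Coprime
open import Data.Nat.Divisibility using (_∣_; divides; ∣-trans; _∣0; ∣m∣n⇒∣m+n; ∣m+n∣m⇒∣n; ∣-refl; >⇒∤)
open import Data.Nat.Primality using (Prime; prime⇒nonTrivial; prime⇒irreducible; euclidsLemma)
import Data.Nat.Properties as ℕ
open import Data.Product.Base using (∃-syntax; _×_; _,_; proj₁; proj₂)
open import Data.Rational.Base using (ℚ; mkℚ; 0ℚ; 1ℚ; ↥_; ↧_; ↧ₙ_; _/_; _+_; _-_; _*_; -_; toℚᵘ)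
open import Data.Rational.Properties as ℚ using (+-*-commutativeRing; +-0-group)
open import Data.Rational.Unnormalised.Base as ℚᵘ using (mkℚᵘ; *≡*)
import Data.Rational.Unnormalised.Properties as ℚᵘ
open import Data.Sum.Base using (inj₂; [_,_]′)
open import Data.Vec.Base using (Vec; []; _∷_; _∷ʳ_; last)
open import Data.Vec.Properties using (last-∷ʳ)
open import Function.Base using (_∘_)
open import Level using (0ℓ)
open import Relation.Binary.PropositionalEquality using (_≡_; refl; sym; trans; cong; cong₂; subst; module ≡-Reasoning)
open import Relation.Nullary.Decidable using (dec⇒maybe)
open import Relation.Nullary.Negation.Core using (¬_)
open import Relation.Unary using (_∈_)
open import Tactic.RingSolver using (solve-∀)
import Tactic.RingSolver.Core.AlmostCommutativeRing as ACR

open import Algebra.Properties.Group +-0-group using (∙-cancelˡ)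
open import Algebra.Properties.Semiring.Sum (CommutativeRing.semiring +-*-commutativeRing)
  using (sum-cong-≗; sum-permute; ∑-comm; ∑-distrib-+; *-distribˡ-sum; *-distribʳ-sum)

open ≡-Reasoning

-- Rationals and finite sums

-- The symmetry of F comes from generating functions: F(x) is the coefficient of t^p in A(t) (1 -
-- t)^(-x) with A(t) = ∑ a(j) t^j, and membership of a in `S₋` says that A(t/(t - 1)) = -(1 - t)
-- A(t). No power series are formed; the symmetry is obtained by interchanging finite sums. It is an
-- identity of values, and it passes to coefficients because a polynomial over ℚ is determined by
-- its values at the naturals. The obstacle is integrality. R p x has p in its denominators, but its
-- factor a(0) is zero, and every R k x with 0 < k < p has p-integral coefficients. The constant
-- term a(p), whose integrality is not given, cancels from the two sides of the symmetry. The
-- expansion of F(-p-x) in powers of p must come with a p-integral remainder; the Horner recursion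
-- produces that remainder by ring operations alone.

ℚ-ring : ACR.AlmostCommutativeRing 0ℓ 0ℓ
ℚ-ring = ACR.fromCommutativeRing +-*-commutativeRing λ x → dec⇒maybe (0ℚ ℚ.≟ x)

ζ : ℤ → ℚ
ζ i = i / 1

ι : ℕ → ℚ
ι n = ζ (+ n)

inv : ℕ → ℚ
inv n = 1ℚ ÷ℕ n

sgn : ℕ → ℚ
sgn zero    = 1ℚ
sgn (suc n) = - sgn n

-- Reduction to lowest terms does not compute on variables, so identities between fractions are
-- checked in unnormalised form, where they are cross-multiplications.
toℚᵘ-/ : ∀ i d → toℚᵘ (i / suc d) ℚᵘ.≃ mkℚᵘ i d
toℚᵘ-/ i d = ℚ.toℚᵘ-fromℚᵘ (mkℚᵘ i d)

ζ-homo-+ : ∀ i j → ζ (i ℤ.+ j) ≡ ζ i + ζ j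
ζ-homo-+ i j = ℚ.toℚᵘ-injective (ℚᵘ.≃-trans (toℚᵘ-/ (i ℤ.+ j) 0) (ℚᵘ.≃-sym
  (ℚᵘ.≃-trans (ℚ.toℚᵘ-homo-+ (ζ i) (ζ j))
  (ℚᵘ.≃-trans (ℚᵘ.+-cong (toℚᵘ-/ i 0) (toℚᵘ-/ j 0)) (*≡* (alg i j))))))
  where
  alg : ∀ i j → (i ℤ.* + 1 ℤ.+ j ℤ.* + 1) ℤ.* + 1 ≡ (i ℤ.+ j) ℤ.* + 1
  alg = solveℤ-∀

/-split : ∀ i j d → ζ i * (j / suc d) ≡ (i ℤ.* j) / suc d
/-split i j d = ℚ.toℚᵘ-injective (ℚᵘ.≃-trans (ℚ.toℚᵘ-homo-* (ζ i) (j / suc d))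
  (ℚᵘ.≃-trans (ℚᵘ.*-cong (toℚᵘ-/ i 0) (toℚᵘ-/ j d))
  (ℚᵘ.≃-sym (ℚᵘ.≃-trans (toℚᵘ-/ (i ℤ.* j) d)
    (*≡* (cong (λ e → i ℤ.* j ℤ.* + suc e) (ℕ.+-identityʳ d)))))))

ζ-homo-* : ∀ i j → ζ (i ℤ.* j) ≡ ζ i * ζ j
ζ-homo-* i j = sym (/-split i j 0)

ι-suc : ∀ n → ι (suc n) ≡ 1ℚ + ι n
ι-suc n = ζ-homo-+ (+ 1) (+ n)

ι-homo-+ : ∀ m n → ι (m ℕ.+ n) ≡ ι m + ι n
ι-homo-+ m n = ζ-homo-+ (+ m) (+ n)

ι-homo-* : ∀ m n → ι (m ℕ.* n) ≡ ι m * ι n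
ι-homo-* m n = trans (cong ζ (ℤ.pos-* m n)) (ζ-homo-* (+ m) (+ n))

/-as-* : ∀ i d → i / suc d ≡ ζ i * inv (suc d)
/-as-* i d = sym (trans (cong (ζ i *_) (ℚ.*-identityˡ (+ 1 / suc d)))
  (trans (/-split i (+ 1) d) (cong (_/ suc d) (ℤ.*-identityʳ i))))

ι*inv : ∀ n → ι (suc n) * inv (suc n) ≡ 1ℚ
ι*inv n = trans (sym (/-as-* (+ suc n) n))
  (ℚ.toℚᵘ-injective (ℚᵘ.≃-trans (toℚᵘ-/ (+ suc n) n)
    (*≡* (trans (ℤ.*-identityʳ (+ suc n)) (sym (ℤ.*-identityˡ (+ suc n)))))))

ι-cancelˡ : ∀ n {x y} → ι (suc n) * x ≡ ι (suc n) * y → x ≡ y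
ι-cancelˡ n {x} {y} eq = begin
  x                               ≡⟨ expand x ⟩
  inv (suc n) * (ι (suc n) * x)   ≡⟨ cong (inv (suc n) *_) eq ⟩
  inv (suc n) * (ι (suc n) * y)   ≡⟨ expand y ⟨
  y                               ∎
  where
  alg : ∀ i v z → i * v * z ≡ v * (i * z)
  alg = solve-∀ ℚ-ring
  expand : ∀ z → z ≡ inv (suc n) * (ι (suc n) * z)
  expand z = trans (sym (ℚ.*-identityˡ z)) (trans (cong (_* z) (sym (ι*inv n)))
    (alg (ι (suc n)) (inv (suc n)) z))

-- The dummy value 0 at divisor 0 is multiplicative too, so products of indices can be inverted
-- without carrying positivity proofs.
inv-homo-* : ∀ m n → inv (m ℕ.* n) ≡ inv m * inv n
inv-homo-* zero    n       = sym (ℚ.*-zeroˡ (inv n))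
inv-homo-* (suc m) zero    = trans (cong inv (ℕ.*-zeroʳ m)) (sym (ℚ.*-zeroʳ (inv (suc m))))
inv-homo-* (suc m) (suc n) = ι-cancelˡ (n ℕ.+ m ℕ.* suc n) (begin
  ι (suc m ℕ.* suc n) * inv (suc m ℕ.* suc n)                 ≡⟨ ι*inv (n ℕ.+ m ℕ.* suc n) ⟩
  1ℚ                                                          ≡⟨ cong₂ _*_ (ι*inv m) (ι*inv n) ⟨
  ι (suc m) * inv (suc m) * (ι (suc n) * inv (suc n))         ≡⟨ alg (ι (suc m)) _ (ι (suc n)) _ ⟩
  ι (suc m) * ι (suc n) * (inv (suc m) * inv (suc n))         ≡⟨ cong (_* (inv (suc m) * inv (suc n))) (ι-homo-* (suc m) (suc n)) ⟨
  ι (suc m ℕ.* suc n) * (inv (suc m) * inv (suc n))           ∎)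
  where
  alg : ∀ i u j v → i * u * (j * v) ≡ i * j * (u * v)
  alg = solve-∀ ℚ-ring

÷ℕ-as-* : ∀ x n → x ÷ℕ n ≡ x * inv n
÷ℕ-as-* x zero    = sym (ℚ.*-zeroʳ x)
÷ℕ-as-* x (suc n) = cong (x *_) (sym (ℚ.*-identityˡ (+ 1 / suc n)))

ζ-[-1]^ : ∀ n → ζ (-1ℤ ℤ.^ n) ≡ sgn n
ζ-[-1]^ zero    = refl
ζ-[-1]^ (suc n) = begin
  ζ (-1ℤ ℤ.* -1ℤ ℤ.^ n)   ≡⟨ ζ-homo-* -1ℤ (-1ℤ ℤ.^ n) ⟩
  - 1ℚ * ζ (-1ℤ ℤ.^ n)    ≡⟨ cong (- 1ℚ *_) (ζ-[-1]^ n) ⟩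
  - 1ℚ * sgn n            ≡⟨ ℚ.neg-distribˡ-* 1ℚ (sgn n) ⟨
  - (1ℚ * sgn n)          ≡⟨ cong -_ (ℚ.*-identityˡ (sgn n)) ⟩
  - sgn n                 ∎

sgn-homo-+ : ∀ m n → sgn (m ℕ.+ n) ≡ sgn m * sgn n
sgn-homo-+ zero    n = sym (ℚ.*-identityˡ (sgn n))
sgn-homo-+ (suc m) n = trans (cong -_ (sgn-homo-+ m n)) (ℚ.neg-distribˡ-* (sgn m) (sgn n))

sum-cong-< : ∀ n {f g : ℕ → ℚ} → (∀ k → k < n → f k ≡ g k) →
             ∑[ i < n ] f (toℕ i) ≡ ∑[ i < n ] g (toℕ i)
sum-cong-< n eq = sum-cong-≗ {n} λ i → eq (toℕ i) (toℕ<n i)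

sum-zero : ∀ n {f : ℕ → ℚ} → (∀ k → k < n → f k ≡ 0ℚ) → ∑[ i < n ] f (toℕ i) ≡ 0ℚ
sum-zero zero    eq = refl
sum-zero (suc n) eq = cong₂ _+_ (eq 0 (s≤s z≤n)) (sum-zero n λ k k<n → eq (suc k) (s≤s k<n))

sum-last : ∀ n (f : ℕ → ℚ) → ∑[ i ≤ n ] f (toℕ i) ≡ ∑[ i < n ] f (toℕ i) + f n
sum-last zero    f = ℚ.+-comm (f 0) 0ℚ
sum-last (suc n) f = trans (cong (λ s → f 0 + s) (sum-last n (f ∘ suc))) (sym (ℚ.+-assoc (f 0) _ _))

sum-extend : ∀ m d (f : ℕ → ℚ) → (∀ k → m ≤ k → f k ≡ 0ℚ) →
             ∑[ i < m ] f (toℕ i) ≡ ∑[ i < m ℕ.+ d ] f (toℕ i)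
sum-extend zero    d f eq = sym (sum-zero d λ k _ → eq k z≤n)
sum-extend (suc m) d f eq = cong (λ s → f 0 + s) (sum-extend m d (f ∘ suc) λ k m≤k → eq (suc k) (s≤s m≤k))

sum-reverse : ∀ n (f : ℕ → ℚ) → ∑[ i ≤ n ] f (toℕ i) ≡ ∑[ i ≤ n ] f (n ∸ toℕ i)
sum-reverse n f = trans (sum-permute {suc n} (f ∘ toℕ) reverse)
  (sum-cong-≗ {suc n} λ i → cong f (opposite-prop i))

-- Rising factorials and the reflection of the generating function

-- Coefficient k of (1 - t)⁻ˣ as a power series in t, i.e. x(x+1)⋯(x+k-1)/k!.
R : ℕ → ℚ → ℚ
R zero    x = 1ℚ
R (suc k) x = R k x * (x + ι k) * inv (suc k)

-- The definition peels off the last factor x + k; this peels off the first factor x, leaving the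
-- product that starts at x + 1.
R-left : ∀ k x → R (suc k) x ≡ x * inv (suc k) * R k (x + 1ℚ)
R-left zero    x = alg x (inv 1)
  where
  alg : ∀ x v → 1ℚ * (x + 0ℚ) * v ≡ x * v * 1ℚ
  alg = solve-∀ ℚ-ring
R-left (suc k) x = begin
  R (suc k) x * (x + ι (suc k)) * v                        ≡⟨ cong₂ (λ r i → r * (x + i) * v) (R-left k x) (ι-suc k) ⟩
  x * inv (suc k) * R k (x + 1ℚ) * (x + (1ℚ + ι k)) * v    ≡⟨ alg x (inv (suc k)) (R k (x + 1ℚ)) (ι k) v ⟩
  x * v * (R k (x + 1ℚ) * (x + 1ℚ + ι k) * inv (suc k))    ∎
  where
  v = inv (suc (suc k))
  alg : ∀ x u r i v → x * u * r * (x + (1ℚ + i)) * v ≡ x * v * (r * (x + 1ℚ + i) * u)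
  alg = solve-∀ ℚ-ring

-- Compares coefficients in (1 - t)^(-x) = (1 - t) (1 - t)^(-(x+1)).
R-pascal : ∀ k x → R (suc k) (x + 1ℚ) ≡ R (suc k) x + R k (x + 1ℚ)
R-pascal k x = begin
  r * (x + 1ℚ + ι k) * v           ≡⟨ alg r x (ι k) v ⟩
  x * v * r + (1ℚ + ι k) * v * r   ≡⟨ cong (λ i → x * v * r + i * v * r) (ι-suc k) ⟨
  x * v * r + ι (suc k) * v * r    ≡⟨ cong₂ (λ s i → s + i * r) (R-left k x) (sym (ι*inv k)) ⟨
  R (suc k) x + 1ℚ * r             ≡⟨ cong (λ s → R (suc k) x + s) (ℚ.*-identityˡ r) ⟩
  R (suc k) x + r                  ∎
  where
  r = R k (x + 1ℚ)
  v = inv (suc k)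
  alg : ∀ r x i v → r * (x + 1ℚ + i) * v ≡ x * v * r + (1ℚ + i) * v * r
  alg = solve-∀ ℚ-ring

-- The factors at 1 - x - k are those at x, negated and in reverse order.
R-reflect : ∀ k x → R k (1ℚ - x - ι k) ≡ sgn k * R k x
R-reflect zero    x = refl
R-reflect (suc k) x = begin
  R (suc k) (1ℚ - x - ι (suc k))                        ≡⟨ cong (λ i → R (suc k) (1ℚ - x - i)) (ι-suc k) ⟩
  R (suc k) y                                           ≡⟨ R-left k y ⟩
  y * v * R k (y + 1ℚ)                                  ≡⟨ cong (λ z → y * v * R k z) (shift x (ι k)) ⟩
  y * v * R k (1ℚ - x - ι k)                            ≡⟨ cong (y * v *_) (R-reflect k x) ⟩
  y * v * (sgn k * R k x)                               ≡⟨ alg x (ι k) v (sgn k) (R k x) ⟩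
  - sgn k * (R k x * (x + ι k) * v)                     ∎
  where
  y = 1ℚ - x - (1ℚ + ι k)
  v = inv (suc k)
  shift : ∀ x i → 1ℚ - x - (1ℚ + i) + 1ℚ ≡ 1ℚ - x - i
  shift = solve-∀ ℚ-ring
  alg : ∀ x i v s r → (1ℚ - x - (1ℚ + i)) * v * (s * r) ≡ - s * (r * (x + i) * v)
  alg = solve-∀ ℚ-ring

-- Partial sums of coefficients amount to multiplication by 1/(1 - t).
∑R : ∀ n x → ∑[ k ≤ n ] R (toℕ k) x ≡ R n (x + 1ℚ)
∑R zero    x = refl
∑R (suc n) x = begin
  ∑[ k ≤ suc n ] R (toℕ k) x               ≡⟨ sum-last (suc n) (λ k → R k x) ⟩
  ∑[ k ≤ n ] R (toℕ k) x + R (suc n) x     ≡⟨ cong (_+ R (suc n) x) (∑R n x) ⟩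
  R n (x + 1ℚ) + R (suc n) x               ≡⟨ ℚ.+-comm (R n (x + 1ℚ)) (R (suc n) x) ⟩
  R (suc n) x + R n (x + 1ℚ)               ≡⟨ R-pascal n x ⟨
  R (suc n) (x + 1ℚ)                       ∎

-- A Cauchy product: the numbers (m choose i) have generating function t^i (1 - t)^(-(i+1)), here
-- multiplied by (1 - t)^(-x).
convR : ℕ → ℕ → ℚ → ℚ
convR i n x = ∑[ k ≤ n ] (ι ((n ∸ toℕ k) C i) * R (toℕ k) x)

-- Pascal's rule in each term; the surplus term k = n + 1 on the left carries (0 choose i+1) = 0.
convR-suc : ∀ i n x → convR (suc i) (suc n) x ≡ convR i n x + convR (suc i) n x
convR-suc i n x = begin
  ∑[ k ≤ suc n ] f (toℕ k)                        ≡⟨ sum-last (suc n) f ⟩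
  ∑[ k ≤ n ] f (toℕ k) + f (suc n)                ≡⟨ cong₂ _+_ (sum-cong-< (suc n) λ k k<1+n → pascal k (s≤s⁻¹ k<1+n)) last-zero ⟩
  ∑[ k ≤ n ] (g (toℕ k) + h (toℕ k)) + 0ℚ         ≡⟨ ℚ.+-identityʳ _ ⟩
  ∑[ k ≤ n ] (g (toℕ k) + h (toℕ k))              ≡⟨ ∑-distrib-+ {suc n} (g ∘ toℕ) (h ∘ toℕ) ⟩
  convR i n x + convR (suc i) n x                 ∎
  where
  f g h : ℕ → ℚ
  f k = ι ((suc n ∸ k) C suc i) * R k x
  g k = ι ((n ∸ k) C i) * R k x
  h k = ι ((n ∸ k) C suc i) * R k x
  last-zero : f (suc n) ≡ 0ℚ
  last-zero = trans (cong (λ m → ι m * R (suc n) x)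
    (trans (cong (_C suc i) (ℕ.n∸n≡0 (suc n))) (k>n⇒nCk≡0 (s≤s (z≤n {i})))))
    (ℚ.*-zeroˡ (R (suc n) x))
  pascal : ∀ k → k ≤ n → f k ≡ g k + h k
  pascal k k≤n = begin
    ι ((suc n ∸ k) C suc i) * R k x
      ≡⟨ cong (λ m → ι (m C suc i) * R k x) (ℕ.+-∸-assoc 1 k≤n) ⟩
    ι (suc (n ∸ k) C suc i) * R k x
      ≡⟨ cong (λ m → ι m * R k x) (nCk+nC[k+1]≡[n+1]C[k+1] (n ∸ k) i) ⟨
    ι ((n ∸ k) C i ℕ.+ (n ∸ k) C suc i) * R k x
      ≡⟨ cong (_* R k x) (ι-homo-+ ((n ∸ k) C i) ((n ∸ k) C suc i)) ⟩
    (ι ((n ∸ k) C i) + ι ((n ∸ k) C suc i)) * R k x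
      ≡⟨ ℚ.*-distribʳ-+ (R k x) (ι ((n ∸ k) C i)) _ ⟩
    g k + h k ∎

convR-zero : ∀ {i n} x → n < i → convR i n x ≡ 0ℚ
convR-zero {i} {n} x n<i = sum-zero (suc n) λ k _ →
  trans (cong (λ m → ι m * R k x) (k>n⇒nCk≡0 (ℕ.≤-<-trans (ℕ.m∸n≤m n k) n<i)))
        (ℚ.*-zeroˡ (R k x))

-- Both sides are the coefficient of t^d in (1 - t)^-(x+i+1); the right-hand side is
-- the binomial coefficient (x+i+d choose d).
convR-closed : ∀ i d x → convR i (i ℕ.+ d) x ≡ sgn d * R d (- x - ι (i ℕ.+ d))
convR-closed zero d x = begin
  convR 0 d x                                ≡⟨ sum-cong-< (suc d) (λ k _ → ℚ.*-identityˡ (R k x)) ⟩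
  ∑[ k ≤ d ] R (toℕ k) x                     ≡⟨ ∑R d x ⟩
  R d (x + 1ℚ)                               ≡⟨ cong (R d) (alg x (ι d)) ⟩
  R d (1ℚ - (- x - ι d) - ι d)               ≡⟨ R-reflect d (- x - ι d) ⟩
  sgn d * R d (- x - ι d)                    ∎
  where
  alg : ∀ x i → x + 1ℚ ≡ 1ℚ - (- x - i) - i
  alg = solve-∀ ℚ-ring
convR-closed (suc i) zero x = begin
  convR (suc i) (suc (i ℕ.+ 0)) x                          ≡⟨ convR-suc i (i ℕ.+ 0) x ⟩
  convR i (i ℕ.+ 0) x + convR (suc i) (i ℕ.+ 0) x          ≡⟨ cong₂ _+_ (convR-closed i 0 x) (convR-zero x (s≤s (ℕ.≤-reflexive (ℕ.+-identityʳ i)))) ⟩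
  1ℚ * 1ℚ                                                  ∎
convR-closed (suc i) (suc d) x = begin
  convR (suc i) (suc (i ℕ.+ suc d)) x
    ≡⟨ convR-suc i (i ℕ.+ suc d) x ⟩
  convR i (i ℕ.+ suc d) x + convR (suc i) (i ℕ.+ suc d) x
    ≡⟨ cong₂ _+_ (convR-closed i (suc d) x) lower ⟩
  - sgn d * R (suc d) y + sgn d * R d y
    ≡⟨ cong (λ w → - sgn d * R (suc d) w + sgn d * R d w) y≡z+1 ⟩
  - sgn d * R (suc d) (z + 1ℚ) + sgn d * R d (z + 1ℚ)
    ≡⟨ cong (λ r → - sgn d * r + sgn d * R d (z + 1ℚ)) (R-pascal d z) ⟩
  - sgn d * (R (suc d) z + R d (z + 1ℚ)) + sgn d * R d (z + 1ℚ)
    ≡⟨ alg (sgn d) (R (suc d) z) (R d (z + 1ℚ)) ⟩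
  - sgn d * R (suc d) z ∎
  where
  y = - x - ι (i ℕ.+ suc d)
  z = - x - ι (suc (i ℕ.+ suc d))
  -- The recursive call has upper index `suc i + d`, which equals `i + suc d` only propositionally;
  -- after transport both summands have the argument `y`, and `R-pascal` at `z` = `y` - 1 merges
  -- them.
  lower : convR (suc i) (i ℕ.+ suc d) x ≡ sgn d * R d y
  lower = subst (λ m → convR (suc i) m x ≡ sgn d * R d (- x - ι m)) (sym (ℕ.+-suc i d))
    (convR-closed (suc i) d x)
  shift : ∀ x i → - x - i ≡ - x - (1ℚ + i) + 1ℚ
  shift = solve-∀ ℚ-ring
  y≡z+1 : y ≡ z + 1ℚ
  y≡z+1 = trans (shift x (ι (i ℕ.+ suc d)))
    (cong (λ j → - x - j + 1ℚ) (sym (ι-suc (i ℕ.+ suc d))))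
  alg : ∀ s r u → - s * (r + u) + s * u ≡ - s * r
  alg = solve-∀ ℚ-ring

-- At n = p this is F of the overview.
gen : (ℕ → ℚ) → ℕ → ℚ → ℚ
gen a n x = ∑[ k ≤ n ] (a (n ∸ toℕ k) * R (toℕ k) x)

-- The common upper bound n makes the double sum in `gen-reflect` rectangular, so that its order can
-- be exchanged.
T-extend : ∀ a {r n} → r ≤ n → T a r ≡ ∑[ i ≤ n ] (ι (r C toℕ i) * sgn (toℕ i) * a (toℕ i))
T-extend a {r} {n} r≤n = begin
  T a r                              ≡⟨ sum-cong-< (suc r) (λ i _ → cong (_* a i)
                                          (trans (ζ-homo-* (+ (r C i)) (-1ℤ ℤ.^ i)) (cong (ι (r C i) *_) (ζ-[-1]^ i)))) ⟩
  ∑[ i ≤ r ] f (toℕ i)               ≡⟨ sum-extend (suc r) (n ∸ r) f vanish ⟩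
  ∑[ i ≤ r ℕ.+ (n ∸ r) ] f (toℕ i)   ≡⟨ cong (λ m → ∑[ i ≤ m ] f (toℕ i)) (ℕ.m+[n∸m]≡n r≤n) ⟩
  ∑[ i ≤ n ] f (toℕ i)               ∎
  where
  f : ℕ → ℚ
  f i = ι (r C i) * sgn i * a i
  alg : ∀ s x → 0ℚ * s * x ≡ 0ℚ
  alg = solve-∀ ℚ-ring
  vanish : ∀ i → r < i → f i ≡ 0ℚ
  vanish i r<i = trans (cong (λ m → ι m * sgn i * a i) (k>n⇒nCk≡0 r<i)) (alg (sgn i) (a i))

gen-reflect : ∀ a → a ∈ S₋ → ∀ n x → gen a n x ≡ - sgn n * gen a n (- x - ι n)
gen-reflect a a∈S₋ n x = begin
  ∑[ k ≤ n ] (a (n ∸ toℕ k) * R (toℕ k) x)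
    ≡⟨ sum-cong-< (suc n) (λ k _ → expand k) ⟩
  ∑[ k ≤ n ] ∑[ i ≤ n ] c (toℕ k) (toℕ i)
    ≡⟨ ∑-comm {suc n} {suc n} (λ k i → c (toℕ k) (toℕ i)) ⟩
  ∑[ i ≤ n ] ∑[ k ≤ n ] c (toℕ k) (toℕ i)
    ≡⟨ sum-cong-< (suc n) (λ i i<1+n → collect i (s≤s⁻¹ i<1+n)) ⟩
  ∑[ i ≤ n ] (- sgn n * (a (toℕ i) * R (n ∸ toℕ i) y))
    ≡⟨ *-distribˡ-sum {suc n} (- sgn n) (λ i → a (toℕ i) * R (n ∸ toℕ i) y) ⟨
  - sgn n * ∑[ i ≤ n ] (a (toℕ i) * R (n ∸ toℕ i) y)
    ≡⟨ cong (- sgn n *_) (sum-reverse n (λ i → a i * R (n ∸ i) y)) ⟩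
  - sgn n * ∑[ k ≤ n ] (a (n ∸ toℕ k) * R (n ∸ (n ∸ toℕ k)) y)
    ≡⟨ cong (- sgn n *_) (sum-cong-< (suc n) λ k k<1+n →
         cong (λ m → a (n ∸ k) * R m y) (ℕ.m∸[m∸n]≡n (s≤s⁻¹ k<1+n))) ⟩
  - sgn n * gen a n y ∎
  where
  y = - x - ι n
  c : ℕ → ℕ → ℚ
  c k i = - (sgn i * a i) * (ι ((n ∸ k) C i) * R k x)
  neg-neg : ∀ u r → u * r ≡ - u * - r
  neg-neg = solve-∀ ℚ-ring
  alg₁ : ∀ b s u r → b * s * u * - r ≡ - (s * u) * (b * r)
  alg₁ = solve-∀ ℚ-ring
  expand : ∀ k → a (n ∸ k) * R k x ≡ ∑[ i ≤ n ] c k (toℕ i)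
  expand k = begin
    -- Two signs are inserted to expose `- a (n ∸ k)`, the form that the eigenvector equation
    -- rewrites.
    a (n ∸ k) * R k x            ≡⟨ neg-neg (a (n ∸ k)) (R k x) ⟩
    - a (n ∸ k) * - R k x        ≡⟨ cong (_* - R k x) (a∈S₋ (n ∸ k)) ⟨
    T a (n ∸ k) * - R k x        ≡⟨ cong (_* - R k x) (T-extend a (ℕ.m∸n≤m n k)) ⟩
    ∑[ i ≤ n ] (ι ((n ∸ k) C toℕ i) * sgn (toℕ i) * a (toℕ i)) * - R k x
      ≡⟨ *-distribʳ-sum {suc n} (- R k x) (λ i → ι ((n ∸ k) C toℕ i) * sgn (toℕ i) * a (toℕ i)) ⟩
    ∑[ i ≤ n ] (ι ((n ∸ k) C toℕ i) * sgn (toℕ i) * a (toℕ i) * - R k x)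
      ≡⟨ sum-cong-< (suc n) (λ i _ → alg₁ (ι ((n ∸ k) C i)) (sgn i) (a i) (R k x)) ⟩
    ∑[ i ≤ n ] c k (toℕ i) ∎
  alg₂ : ∀ s u t r → - (s * u) * (t * r) ≡ - (s * t) * (u * r)
  alg₂ = solve-∀ ℚ-ring
  collect : ∀ i → i ≤ n → ∑[ k ≤ n ] c (toℕ k) i ≡ - sgn n * (a i * R (n ∸ i) y)
  collect i i≤n = begin
    ∑[ k ≤ n ] c (toℕ k) i
      ≡⟨ *-distribˡ-sum {suc n} (- (sgn i * a i)) (λ k → ι ((n ∸ toℕ k) C i) * R (toℕ k) x) ⟨
    - (sgn i * a i) * convR i n x
      ≡⟨ cong (- (sgn i * a i) *_) closed ⟩
    - (sgn i * a i) * (sgn (n ∸ i) * R (n ∸ i) y)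
      ≡⟨ alg₂ (sgn i) (a i) (sgn (n ∸ i)) (R (n ∸ i) y) ⟩
    - (sgn i * sgn (n ∸ i)) * (a i * R (n ∸ i) y)
      ≡⟨ cong (λ s → - s * (a i * R (n ∸ i) y)) (trans (sym (sgn-homo-+ i (n ∸ i))) (cong sgn (ℕ.m+[n∸m]≡n i≤n))) ⟩
    - sgn n * (a i * R (n ∸ i) y) ∎
    where
    closed : convR i n x ≡ sgn (n ∸ i) * R (n ∸ i) y
    closed = subst (λ m → convR i m x ≡ sgn (n ∸ i) * R (n ∸ i) (- x - ι m)) (ℕ.m+[n∸m]≡n i≤n)
      (convR-closed i (n ∸ i) x)

-- Polynomials as coefficient sequences

-- Horner form. A polynomial is a total sequence with a separate length, so later coefficients such
-- as `f (2 ℕ.+ k)` need no range check.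
eval : ℕ → (ℕ → ℚ) → ℚ → ℚ
eval zero    f x = 0ℚ
eval (suc n) f x = f 0 + x * eval n (f ∘ suc) x

eval-cong : ∀ n {f g} x → (∀ k → k < n → f k ≡ g k) → eval n f x ≡ eval n g x
eval-cong zero    x eq = refl
eval-cong (suc n) x eq = cong₂ (λ c e → c + x * e) (eq 0 (s≤s z≤n))
  (eval-cong n x λ k k<n → eq (suc k) (s≤s k<n))

eval-zero : ∀ n {f} x → (∀ k → k < n → f k ≡ 0ℚ) → eval n f x ≡ 0ℚ
eval-zero zero    x eq = refl
eval-zero (suc n) x eq = trans (cong₂ (λ c e → c + x * e) (eq 0 (s≤s z≤n))
  (eval-zero n x λ k k<n → eq (suc k) (s≤s k<n))) (alg x)
  where
  alg : ∀ x → 0ℚ + x * 0ℚ ≡ 0ℚ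
  alg = solve-∀ ℚ-ring

eval-linear : ∀ n f g c x → eval n (λ k → f k + c * g k) x ≡ eval n f x + c * eval n g x
eval-linear zero    f g c x = alg c
  where
  alg : ∀ c → 0ℚ ≡ 0ℚ + c * 0ℚ
  alg = solve-∀ ℚ-ring
eval-linear (suc n) f g c x = trans
  (cong (λ e → f 0 + c * g 0 + x * e) (eval-linear n (f ∘ suc) (g ∘ suc) c x))
  (alg (f 0) (g 0) (eval n (f ∘ suc) x) (eval n (g ∘ suc) x) c x)
  where
  alg : ∀ u v d e c x → u + c * v + x * (d + c * e) ≡ u + x * d + c * (v + x * e)
  alg = solve-∀ ℚ-ring

eval-pad : ∀ n f x → f n ≡ 0ℚ → eval (suc n) f x ≡ eval n f x
eval-pad zero    f x eq = trans (cong (_+ x * 0ℚ) eq) (alg x)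
  where
  alg : ∀ x → 0ℚ + x * 0ℚ ≡ 0ℚ
  alg = solve-∀ ℚ-ring
eval-pad (suc n) f x eq = cong (λ e → f 0 + x * e) (eval-pad n (f ∘ suc) x eq)

-- Synthetic division: for f with n+1 coefficients, quotient n (f ∘ suc) r holds the
-- coefficients of (f(x) - f(r)) / (x - r).
quotient : ℕ → (ℕ → ℚ) → ℚ → ℕ → ℚ
quotient zero    g r k       = 0ℚ
quotient (suc n) g r zero    = eval (suc n) g r
quotient (suc n) g r (suc k) = quotient n (g ∘ suc) r k

eval-quotient : ∀ n f r x →
  eval (suc n) f x - eval (suc n) f r ≡ (x - r) * eval n (quotient n (f ∘ suc) r) x
eval-quotient zero f r x = alg (f 0) r x
  where
  alg : ∀ c r x → c + x * 0ℚ - (c + r * 0ℚ) ≡ (x - r) * 0ℚ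
  alg = solve-∀ ℚ-ring
eval-quotient (suc n) f r x = begin
  f 0 + x * gx - (f 0 + r * gr)                 ≡⟨ alg₁ (f 0) x r gx gr ⟩
  (x - r) * gr + x * (gx - gr)                  ≡⟨ cong (λ d → (x - r) * gr + x * d) (eval-quotient n (f ∘ suc) r x) ⟩
  (x - r) * gr + x * ((x - r) * q)              ≡⟨ alg₂ x r gr q ⟩
  (x - r) * (gr + x * q)                        ∎
  where
  gx = eval (suc n) (f ∘ suc) x
  gr = eval (suc n) (f ∘ suc) r
  q  = eval n (quotient n (f ∘ suc ∘ suc) r) x
  alg₁ : ∀ c x r u v → c + x * u - (c + r * v) ≡ (x - r) * v + x * (u - v)
  alg₁ = solve-∀ ℚ-ring
  alg₂ : ∀ x r v q → (x - r) * v + x * ((x - r) * q) ≡ (x - r) * (v + x * q)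
  alg₂ = solve-∀ ℚ-ring

constant-term : ∀ n f x → eval (suc n) f x ≡ 0ℚ → (∀ k → k < n → f (suc k) ≡ 0ℚ) → f 0 ≡ 0ℚ
constant-term n f x eq tail≡0 = begin
  f 0                               ≡⟨ alg (f 0) x ⟩
  f 0 + x * 0ℚ                      ≡⟨ cong (λ e → f 0 + x * e) (eval-zero n x tail≡0) ⟨
  f 0 + x * eval n (f ∘ suc) x      ≡⟨ eq ⟩
  0ℚ                                ∎
  where
  alg : ∀ c x → c ≡ c + x * 0ℚ
  alg = solve-∀ ℚ-ring

-- Each quotient coefficient is a tail of `g` evaluated at `r`, so the system is triangular: once
-- the higher coefficients vanish, the tail is just its constant term.
quotient-zero : ∀ n g r → (∀ k → k < n → quotient n g r k ≡ 0ℚ) → ∀ k → k < n → g k ≡ 0ℚ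
quotient-zero (suc n) g r eq = λ where
    zero    _         → constant-term n g r (eq 0 (s≤s z≤n)) tail≡0
    (suc k) (s≤s k<n) → tail≡0 k k<n
  where
  tail≡0 : ∀ k → k < n → g (suc k) ≡ 0ℚ
  tail≡0 = quotient-zero n (g ∘ suc) r λ k k<n → eq (suc k) (s≤s k<n)

-- Roots are split off in increasing order, hence the moving start m: after division by x - m the
-- quotient has one coefficient fewer and vanishes from m + 1 on, where x - m is nonzero.
zero-on-ℕ⇒zero : ∀ n f m → (∀ d → eval n f (ι (m ℕ.+ d)) ≡ 0ℚ) → ∀ k → k < n → f k ≡ 0ℚ
zero-on-ℕ⇒zero (suc n) f m eq = λ where
    zero    _         → constant-term n f (ι m) f[m]≡0 tail≡0
    (suc k) (s≤s k<n) → tail≡0 k k<n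
  where
  f[m]≡0 : eval (suc n) f (ι m) ≡ 0ℚ
  f[m]≡0 = trans (cong (eval (suc n) f ∘ ι) (sym (ℕ.+-identityʳ m))) (eq 0)
  q : ℚ → ℚ
  q = eval n (quotient n (f ∘ suc) (ι m))
  difference : ∀ d → ι (m ℕ.+ suc d) - ι m ≡ ι (suc d)
  difference d = trans (cong (_- ι m) (ι-homo-+ m (suc d))) (alg (ι m) (ι (suc d)))
    where
    alg : ∀ i j → i + j - i ≡ j
    alg = solve-∀ ℚ-ring
  q≡0 : ∀ d → q (ι (suc m ℕ.+ d)) ≡ 0ℚ
  q≡0 d = trans (cong (q ∘ ι) (sym (ℕ.+-suc m d))) (ι-cancelˡ d (begin
    ι (suc d) * q x                            ≡⟨ cong (_* q x) (difference d) ⟨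
    (x - ι m) * q x                            ≡⟨ eval-quotient n f (ι m) x ⟨
    eval (suc n) f x - eval (suc n) f (ι m)    ≡⟨ cong₂ _-_ (eq (suc d)) f[m]≡0 ⟩
    0ℚ                                         ≡⟨ ℚ.*-zeroʳ (ι (suc d)) ⟨
    ι (suc d) * 0ℚ                             ∎))
    where
    x = ι (m ℕ.+ suc d)
  tail≡0 : ∀ k → k < n → f (suc k) ≡ 0ℚ
  tail≡0 = quotient-zero n (f ∘ suc) (ι m)
    (zero-on-ℕ⇒zero n (quotient n (f ∘ suc) (ι m)) (suc m) q≡0)

equal-on-ℕ⇒equal : ∀ n f g → (∀ m → eval n f (ι m) ≡ eval n g (ι m)) → ∀ k → k < n → f k ≡ g k
equal-on-ℕ⇒equal n f g eq k k<n = begin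
  f k                          ≡⟨ alg (f k) (g k) ⟩
  f k + - 1ℚ * g k + g k       ≡⟨ cong (_+ g k) (zero-on-ℕ⇒zero n (λ j → f j + - 1ℚ * g j) 0 difference k k<n) ⟩
  0ℚ + g k                     ≡⟨ ℚ.+-identityˡ (g k) ⟩
  g k                          ∎
  where
  alg : ∀ u v → u ≡ u + - 1ℚ * v + v
  alg = solve-∀ ℚ-ring
  cancel : ∀ u → u + - 1ℚ * u ≡ 0ℚ
  cancel = solve-∀ ℚ-ring
  difference : ∀ m → eval n (λ j → f j + - 1ℚ * g j) (ι m) ≡ 0ℚ
  difference m = trans (eval-linear n f g (- 1ℚ) (ι m))
    (trans (cong (_+ - 1ℚ * eval n g (ι m)) (eq m)) (cancel (eval n g (ι m))))

-- Coefficients of f(-q-x), computed by Horner's scheme.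
reflected : ℕ → (ℕ → ℚ) → ℚ → ℕ → ℚ
reflected zero    f q k       = 0ℚ
reflected (suc n) f q zero    = f 0 - q * reflected n (f ∘ suc) q 0
reflected (suc n) f q (suc k) = - q * reflected n (f ∘ suc) q (suc k) - reflected n (f ∘ suc) q k

reflected-vanish : ∀ n f q k → n ≤ k → reflected n f q k ≡ 0ℚ
reflected-vanish zero    f q k       _         = refl
reflected-vanish (suc n) f q (suc k) (s≤s n≤k) = trans
  (cong₂ (λ u v → - q * u - v) (reflected-vanish n (f ∘ suc) q (suc k) (ℕ.m≤n⇒m≤1+n n≤k))
                               (reflected-vanish n (f ∘ suc) q k n≤k))
  (alg q)
  where
  alg : ∀ q → - q * 0ℚ - 0ℚ ≡ 0ℚ
  alg = solve-∀ ℚ-ring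

eval-reflected : ∀ n f q x → eval n (reflected n f q) x ≡ eval n f (- x - q)
eval-reflected zero    f q x = refl
eval-reflected (suc n) f q x = begin
  f 0 - q * h 0 + x * eval n (λ k → - q * h (suc k) - h k) x
    ≡⟨ cong (λ e → f 0 - q * h 0 + x * e) (eval-cong n x λ k _ → alg₀ q (h (suc k)) (h k)) ⟩
  f 0 - q * h 0 + x * eval n (λ k → - h k + - q * h (suc k)) x
    ≡⟨ cong (λ e → f 0 - q * h 0 + x * e) (eval-linear n (-_ ∘ h) (h ∘ suc) (- q) x) ⟩
  f 0 - q * h 0 + x * (eval n (-_ ∘ h) x + - q * eval n (h ∘ suc) x)
    ≡⟨ cong (λ e → f 0 - q * h 0 + x * (e + - q * eval n (h ∘ suc) x)) (eval-neg n h) ⟩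
  f 0 - q * h 0 + x * (- eval n h x + - q * eval n (h ∘ suc) x)
    ≡⟨ alg₁ (f 0) q (h 0) x (eval n h x) (eval n (h ∘ suc) x) ⟩
  f 0 - q * (h 0 + x * eval n (h ∘ suc) x) - x * eval n h x
    -- The constant `h 0` and the n shifted values make up n + 1 coefficients of `h`, the last of
    -- which is zero.
    ≡⟨ cong (λ e → f 0 - q * e - x * eval n h x) (eval-pad n h x (reflected-vanish n (f ∘ suc) q n ℕ.≤-refl)) ⟩
  f 0 - q * eval n h x - x * eval n h x
    ≡⟨ alg₂ (f 0) q x (eval n h x) ⟩
  f 0 + (- x - q) * eval n h x
    ≡⟨ cong (λ e → f 0 + (- x - q) * e) (eval-reflected n (f ∘ suc) q x) ⟩
  f 0 + (- x - q) * eval n (f ∘ suc) (- x - q) ∎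
  where
  h = reflected n (f ∘ suc) q
  alg₀ : ∀ q u v → - q * u - v ≡ - v + - q * u
  alg₀ = solve-∀ ℚ-ring
  alg₁ : ∀ c q k x u v → c - q * k + x * (- u + - q * v) ≡ c - q * (k + x * v) - x * u
  alg₁ = solve-∀ ℚ-ring
  alg₂ : ∀ c q x u → c - q * u - x * u ≡ c + (- x - q) * u
  alg₂ = solve-∀ ℚ-ring
  eval-neg : ∀ n g → eval n (-_ ∘ g) x ≡ - eval n g x
  eval-neg zero    g = refl
  eval-neg (suc n) g = trans (cong (λ e → - g 0 + x * e) (eval-neg n (g ∘ suc)))
    (alg (g 0) x (eval n (g ∘ suc) x))
    where
    alg : ∀ c x e → - c + x * - e ≡ - (c + x * e)
    alg = solve-∀ ℚ-ring

-- Taylor expansion with remainder in a subring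

-- The binomial coefficients (k+2 choose 2).
tri : ℕ → ℚ
tri zero    = 1ℚ
tri (suc k) = tri k + ι (suc (suc k))

-- Later instantiated with ℤ₍ₚ₎; the expansion uses nothing but closure under these operations.
record IsSubring (P : ℚ → Set) : Set where
  field
    ι∈ : ∀ n → P (ι n)
    +∈ : ∀ {x y} → P x → P y → P (x + y)
    *∈ : ∀ {x y} → P x → P y → P (x * y)
    -∈ : ∀ {x} → P x → P (- x)

module _ {P : ℚ → Set} (isSubring : IsSubring P) where
  open IsSubring isSubring

  tri∈ : ∀ k → P (tri k)
  tri∈ zero    = ι∈ 1
  tri∈ (suc k) = +∈ (tri∈ k) (ι∈ (suc (suc k)))

  -- Taylor expansion of f(-q-x) to second order in q.
  reflected-expand : ∀ n f {q} → P q → (∀ k → P (f k)) → (∀ k → n ≤ k → f k ≡ 0ℚ) → ∀ k →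
    ∃[ z ] P z × reflected n f q k ≡
      sgn k * (f k - ι (suc k) * q * f (suc k) + q * q * (tri k * f (suc (suc k)) + q * z))
  reflected-expand zero f {q} _ _ f≡0 k = 0ℚ , ι∈ 0 ,
    sym (trans (expression (f≡0 k z≤n) (f≡0 (suc k) z≤n) (f≡0 (suc (suc k)) z≤n))
               (alg (sgn k) (ι (suc k)) q (tri k)))
    where
    expression : ∀ {u v w} → f k ≡ u → f (suc k) ≡ v → f (suc (suc k)) ≡ w →
      sgn k * (f k - ι (suc k) * q * f (suc k) + q * q * (tri k * f (suc (suc k)) + q * 0ℚ)) ≡
      sgn k * (u - ι (suc k) * q * v + q * q * (tri k * w + q * 0ℚ))
    expression refl refl refl = refl
    alg : ∀ s i q t → s * (0ℚ - i * q * 0ℚ + q * q * (t * 0ℚ + q * 0ℚ)) ≡ 0ℚ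
    alg = solve-∀ ℚ-ring
  reflected-expand (suc n) f {q} q∈ f∈ f≡0 zero
    with reflected-expand n (f ∘ suc) q∈ (f∈ ∘ suc) (λ k n≤k → f≡0 (suc k) (s≤s n≤k)) 0
  -- The factor `- q` raises the tail's expansion by one order: its second-order coefficient `f 3`
  -- becomes third-order and joins the remainder.
  ... | z , z∈ , eq = - (f 3 + q * z) , -∈ (+∈ (f∈ 3) (*∈ q∈ z∈)) ,
    trans (cong (λ h → f 0 - q * h) eq) (alg (f 0) (f 1) (f 2) (f 3) q z)
    where
    alg : ∀ a b c d q z →
      a - q * (1ℚ * (b - 1ℚ * q * c + q * q * (1ℚ * d + q * z))) ≡
      1ℚ * (a - 1ℚ * q * b + q * q * (1ℚ * c + q * - (d + q * z)))
    alg = solve-∀ ℚ-ring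
  reflected-expand (suc n) f {q} q∈ f∈ f≡0 (suc k)
    with reflected-expand n (f ∘ suc) q∈ (f∈ ∘ suc) (λ k n≤k → f≡0 (suc k) (s≤s n≤k)) k
       | reflected-expand n (f ∘ suc) q∈ (f∈ ∘ suc) (λ k n≤k → f≡0 (suc k) (s≤s n≤k)) (suc k)
  -- Coefficient k of the tail passes on its remainder `z`; coefficient k + 1 is multiplied by q, so
  -- its second-order term and remainder land here. The lower orders add up by Pascal's rule.
  ... | z , z∈ , eq | z′ , z′∈ , eq′ =
    z - (tri (suc k) * f (4 ℕ.+ k) + q * z′) ,
    +∈ z∈ (-∈ (+∈ (*∈ (tri∈ (suc k)) (f∈ (4 ℕ.+ k))) (*∈ q∈ z′∈))) ,
    (begin
      - q * reflected n (f ∘ suc) q (suc k) - reflected n (f ∘ suc) q k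
        ≡⟨ cong₂ (λ u v → - q * u - v) eq′ eq ⟩
      - q * (- s * (c - ι (2 ℕ.+ k) * q * d + q * q * (tri (suc k) * e + q * z′)))
        - s * (b - ι (suc k) * q * c + q * q * (tri k * d + q * z))
        ≡⟨ cong (λ i → - q * (- s * (c - i * q * d + q * q * (t′ * e + q * z′)))
                       - s * (b - ι (suc k) * q * c + q * q * (tri k * d + q * z))) (ι-suc (suc k)) ⟩
      - q * (- s * (c - (1ℚ + ι (suc k)) * q * d + q * q * (t′ * e + q * z′)))
        - s * (b - ι (suc k) * q * c + q * q * (tri k * d + q * z))
        ≡⟨ alg s b c d e q z z′ (ι (suc k)) (tri k) t′ ⟩
      - s * (b - (1ℚ + ι (suc k)) * q * c + q * q * ((tri k + (1ℚ + ι (suc k))) * d + q * w))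
        ≡⟨ cong (λ i → - s * (b - i * q * c + q * q * ((tri k + i) * d + q * w))) (ι-suc (suc k)) ⟨
      - s * (b - ι (2 ℕ.+ k) * q * c + q * q * (t′ * d + q * w)) ∎)
    where
    s = sgn k
    b = f (1 ℕ.+ k)
    c = f (2 ℕ.+ k)
    d = f (3 ℕ.+ k)
    e = f (4 ℕ.+ k)
    t′ = tri (suc k)
    w = z - (t′ * e + q * z′)
    alg : ∀ s b c d e q z z′ i t t′ →
      - q * (- s * (c - (1ℚ + i) * q * d + q * q * (t′ * e + q * z′)))
        - s * (b - i * q * c + q * q * (t * d + q * z)) ≡
      - s * (b - (1ℚ + i) * q * c + q * q * ((t + (1ℚ + i)) * d + q * (z - (t′ * e + q * z′))))
    alg = solve-∀ ℚ-ring

-- The multiple sums as coefficients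

sumIncreasing-cong : ∀ n b {f g : Vec ℕ n → ℚ} → (∀ ks → f ks ≡ g ks) →
                     sumIncreasing n b f ≡ sumIncreasing n b g
sumIncreasing-cong zero    b eq = eq []
sumIncreasing-cong (suc n) b eq = sum-cong-< (pred b) λ i _ →
  sumIncreasing-cong n (suc i) λ ks → eq (ks ∷ʳ suc i)

sumIncreasing-*ˡ : ∀ n b c (f : Vec ℕ n → ℚ) →
                   sumIncreasing n b (λ ks → c * f ks) ≡ c * sumIncreasing n b f
sumIncreasing-*ˡ zero    b c f = refl
sumIncreasing-*ˡ (suc n) b c f = trans
  (sum-cong-< (pred b) λ i _ → sumIncreasing-*ˡ n (suc i) c λ ks → f (ks ∷ʳ suc i))
  (sym (*-distribˡ-sum {pred b} c λ i → sumIncreasing n (suc (toℕ i)) λ ks → f (ks ∷ʳ suc (toℕ i))))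

product-∷ʳ : ∀ {n} (ks : Vec ℕ n) k → product (ks ∷ʳ k) ≡ k ℕ.* product ks
product-∷ʳ []       k = refl
product-∷ʳ (j ∷ ks) k = begin
  j ℕ.* product (ks ∷ʳ k)      ≡⟨ cong (j ℕ.*_) (product-∷ʳ ks k) ⟩
  j ℕ.* (k ℕ.* product ks)     ≡⟨ ℕ.*-assoc j k (product ks) ⟨
  j ℕ.* k ℕ.* product ks       ≡⟨ cong (ℕ._* product ks) (ℕ.*-comm j k) ⟩
  k ℕ.* j ℕ.* product ks       ≡⟨ ℕ.*-assoc k j (product ks) ⟩
  k ℕ.* (j ℕ.* product ks)     ∎

-- The n-th elementary symmetric function of 1, 1/2, …, 1/(b-1).
E : ℕ → ℕ → ℚ
E n b = sumIncreasing n b (inv ∘ product)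

inv-product-∷ʳ : ∀ {n} (ks : Vec ℕ n) k → inv (product (ks ∷ʳ k)) ≡ inv k * inv (product ks)
inv-product-∷ʳ ks k = trans (cong inv (product-∷ʳ ks k)) (inv-homo-* k (product ks))

E-suc : ∀ n b → E (suc n) b ≡ ∑[ i < pred b ] (inv (suc (toℕ i)) * E n (suc (toℕ i)))
E-suc n b = sum-cong-< (pred b) λ i _ → trans
  (sumIncreasing-cong n (suc i) λ ks → inv-product-∷ʳ ks (suc i))
  (sumIncreasing-*ˡ n (suc i) (inv (suc i)) (inv ∘ product))

E-vanish : ∀ n b → b < n → E n (suc b) ≡ 0ℚ
E-vanish (suc n) b (s≤s b≤n) = trans (E-suc n (suc b)) (sum-zero b λ i i<b → trans
  (cong (inv (suc i) *_) (E-vanish n i (ℕ.<-≤-trans i<b b≤n))) (ℚ.*-zeroʳ (inv (suc i))))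

E-step : ∀ n b → E (suc n) (2 ℕ.+ b) ≡ E (suc n) (suc b) + inv (suc b) * E n (suc b)
E-step n b = begin
  E (suc n) (2 ℕ.+ b)                                   ≡⟨ E-suc n (2 ℕ.+ b) ⟩
  ∑[ i ≤ b ] f (toℕ i)                                  ≡⟨ sum-last b f ⟩
  ∑[ i < b ] f (toℕ i) + f b                            ≡⟨ cong (_+ f b) (E-suc n (suc b)) ⟨
  E (suc n) (suc b) + f b                               ∎
  where
  f : ℕ → ℚ
  f i = inv (suc i) * E n (suc i)

-- Passing from b + 1 to b + 2 multiplies the generating polynomial of `E` by 1 + x/(b+1). Any
-- length n > b is allowed because the induction step uses two lengths and `eval-S` a common one for
-- all b.
R-eval-E : ∀ b n x → b < n → R (suc b) x ≡ x * inv (suc b) * eval n (λ m → E m (suc b)) x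
R-eval-E zero (suc n) x _ = begin
  R 1 x                                                     ≡⟨ alg x (inv 1) ⟩
  x * inv 1 * (1ℚ + x * 0ℚ)                                 ≡⟨ cong (λ e → x * inv 1 * (1ℚ + x * e)) (eval-zero n x λ _ _ → refl) ⟨
  x * inv 1 * (1ℚ + x * eval n (λ m → E (suc m) 1) x)       ∎
  where
  alg : ∀ x v → 1ℚ * (x + 0ℚ) * v ≡ x * v * (1ℚ + x * 0ℚ)
  alg = solve-∀ ℚ-ring
R-eval-E (suc b) (suc n) x (s≤s b<n) = sym (begin
  x * v * (1ℚ + x * eval n (λ m → E (suc m) (2 ℕ.+ b)) x)
    ≡⟨ cong (λ e → x * v * (1ℚ + x * e)) (trans (eval-cong n x λ m _ → E-step m b)
         (eval-linear n (λ m → E (suc m) (suc b)) (λ m → E m (suc b)) u x)) ⟩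
  x * v * (1ℚ + x * (eval n (λ m → E (suc m) (suc b)) x + u * eval n (λ m → E m (suc b)) x))
    ≡⟨ alg₁ x v u (eval n (λ m → E (suc m) (suc b)) x) (eval n (λ m → E m (suc b)) x) ⟩
  v * (1ℚ * (x * eval (suc n) (λ m → E m (suc b)) x) + x * (x * u * eval n (λ m → E m (suc b)) x))
    ≡⟨ cong₂ (λ i r → v * (i * (x * eval (suc n) (λ m → E m (suc b)) x) + x * r)) (ι*inv b) (R-eval-E b n x b<n) ⟨
  v * (ι (suc b) * u * (x * eval (suc n) (λ m → E m (suc b)) x) + x * r)
    ≡⟨ alg₂ x v u (ι (suc b)) (eval (suc n) (λ m → E m (suc b)) x) r ⟩
  v * (ι (suc b) * (x * u * eval (suc n) (λ m → E m (suc b)) x) + x * r)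
    ≡⟨ cong (λ s → v * (ι (suc b) * s + x * r)) (R-eval-E b (suc n) x (ℕ.m≤n⇒m≤1+n b<n)) ⟨
  v * (ι (suc b) * r + x * r)
    ≡⟨ alg₃ v (ι (suc b)) r x ⟩
  r * (x + ι (suc b)) * v ∎)
  where
  u = inv (suc b)
  v = inv (2 ℕ.+ b)
  r = R (suc b) x
  alg₁ : ∀ x v u e d → x * v * (1ℚ + x * (e + u * d)) ≡ v * (1ℚ * (x * (1ℚ + x * e)) + x * (x * u * d))
  alg₁ = solve-∀ ℚ-ring
  alg₂ : ∀ x v u i e r → v * (i * u * (x * e) + x * r) ≡ v * (i * (x * u * e) + x * r)
  alg₂ = solve-∀ ℚ-ring
  alg₃ : ∀ v i r x → v * (i * r + x * r) ≡ r * (x + i) * v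
  alg₃ = solve-∀ ℚ-ring

-- The value 0 at index 0, where there is no multiple sum, makes this the coefficient sequence of
-- F(x) - a(p).
S : (ℕ → ℚ) → ℕ → ℕ → ℚ
S a p zero    = 0ℚ
S a p (suc m) = multiSum a p (suc m)

-- The value of `a` depends only on the largest index, which the outermost sum fixes; the other
-- indices contribute an elementary symmetric function.
S-suc : ∀ a p m → S a p (suc m) ≡
  ∑[ i < pred p ] (a (p ∸ suc (toℕ i)) * inv (suc (toℕ i)) * E m (suc (toℕ i)))
S-suc a p m = sum-cong-< (pred p) λ i _ → trans
  (sumIncreasing-cong m (suc i) λ ks → begin
    a (p ∸ last (ks ∷ʳ suc i)) ÷ℕ product (ks ∷ʳ suc i)
      ≡⟨ ÷ℕ-as-* (a (p ∸ last (ks ∷ʳ suc i))) (product (ks ∷ʳ suc i)) ⟩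
    a (p ∸ last (ks ∷ʳ suc i)) * inv (product (ks ∷ʳ suc i))
      ≡⟨ cong₂ (λ l v → a (p ∸ l) * v) (last-∷ʳ (suc i) ks) (inv-product-∷ʳ ks (suc i)) ⟩
    a (p ∸ suc i) * (inv (suc i) * inv (product ks))
      ≡⟨ ℚ.*-assoc (a (p ∸ suc i)) (inv (suc i)) (inv (product ks)) ⟨
    a (p ∸ suc i) * inv (suc i) * inv (product ks) ∎)
  (sumIncreasing-*ˡ m (suc i) (a (p ∸ suc i) * inv (suc i)) (inv ∘ product))

S-vanish : ∀ a p k → p ≤ k → S a p k ≡ 0ℚ
S-vanish a p zero    _    = refl
S-vanish a p (suc m) p≤1+m = trans (S-suc a p m) (sum-zero (pred p) λ i i<p-1 → trans
  (cong (a (p ∸ suc i) * inv (suc i) *_) (E-vanish m i (ℕ.<-≤-trans i<p-1 (ℕ.pred-mono-≤ p≤1+m))))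
  (ℚ.*-zeroʳ (a (p ∸ suc i) * inv (suc i))))

eval-sum : ∀ n N (c : ℕ → ℚ) (g : ℕ → ℕ → ℚ) x →
  eval n (λ m → ∑[ i < N ] (c (toℕ i) * g (toℕ i) m)) x ≡ ∑[ i < N ] (c (toℕ i) * eval n (g (toℕ i)) x)
eval-sum n zero    c g x = eval-zero n x λ _ _ → refl
eval-sum n (suc N) c g x = begin
  eval n (λ m → ∑[ i ≤ N ] (c (toℕ i) * g (toℕ i) m)) x
    ≡⟨ eval-cong n x (λ m _ → sum-last N (λ i → c i * g i m)) ⟩
  eval n (λ m → ∑[ i < N ] (c (toℕ i) * g (toℕ i) m) + c N * g N m) x
    ≡⟨ eval-linear n (λ m → ∑[ i < N ] (c (toℕ i) * g (toℕ i) m)) (g N) (c N) x ⟩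
  eval n (λ m → ∑[ i < N ] (c (toℕ i) * g (toℕ i) m)) x + c N * eval n (g N) x
    ≡⟨ cong (_+ c N * eval n (g N) x) (eval-sum n N c g x) ⟩
  ∑[ i < N ] (c (toℕ i) * eval n (g (toℕ i)) x) + c N * eval n (g N) x
    ≡⟨ sum-last N (λ i → c i * eval n (g i) x) ⟨
  ∑[ i ≤ N ] (c (toℕ i) * eval n (g (toℕ i)) x) ∎

eval-S : ∀ a P x → eval (suc P) (S a (suc P)) x ≡ ∑[ i < P ] (a (P ∸ toℕ i) * R (suc (toℕ i)) x)
eval-S a P x = begin
  0ℚ + x * eval P (S a (suc P) ∘ suc) x
    ≡⟨ cong (λ e → 0ℚ + x * e) (eval-cong P x λ m _ → S-suc a (suc P) m) ⟩
  0ℚ + x * eval P (λ m → ∑[ i < P ] (c (toℕ i) * E m (suc (toℕ i)))) x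
    ≡⟨ cong (λ e → 0ℚ + x * e) (eval-sum P P c (λ i m → E m (suc i)) x) ⟩
  0ℚ + x * ∑[ i < P ] (c (toℕ i) * eval P (λ m → E m (suc (toℕ i))) x)
    ≡⟨ ℚ.+-identityˡ _ ⟩
  x * ∑[ i < P ] (c (toℕ i) * eval P (λ m → E m (suc (toℕ i))) x)
    ≡⟨ *-distribˡ-sum {P} x (λ i → c (toℕ i) * eval P (λ m → E m (suc (toℕ i))) x) ⟩
  ∑[ i < P ] (x * (c (toℕ i) * eval P (λ m → E m (suc (toℕ i))) x))
    ≡⟨ sum-cong-< P (λ i i<P → trans
         (alg x (a (P ∸ i)) (inv (suc i)) (eval P (λ m → E m (suc i)) x))
         (cong (a (P ∸ i) *_) (sym (R-eval-E i P x i<P)))) ⟩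
  ∑[ i < P ] (a (P ∸ toℕ i) * R (suc (toℕ i)) x) ∎
  where
  c : ℕ → ℚ
  c i = a (P ∸ i) * inv (suc i)
  alg : ∀ x a v e → x * (a * v * e) ≡ a * (x * v * e)
  alg = solve-∀ ℚ-ring

S₋⇒a0≡0 : ∀ a → a ∈ S₋ → a 0 ≡ 0ℚ
S₋⇒a0≡0 a a∈S₋ = ι-cancelˡ 1 (begin
  ι 2 * a 0              ≡⟨ alg₁ (a 0) ⟩
  1ℚ * a 0 + 0ℚ + a 0    ≡⟨ cong (_+ a 0) (a∈S₋ 0) ⟩
  - a 0 + a 0            ≡⟨ ℚ.+-inverseˡ (a 0) ⟩
  ι 2 * 0ℚ               ∎)
  where
  alg₁ : ∀ x → (1ℚ + 1ℚ) * x ≡ 1ℚ * x + 0ℚ + x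
  alg₁ = solve-∀ ℚ-ring

-- The multiple sums account for 0 < k < p; the end terms are a(p) at k = 0 and a multiple of a(0) =
-- 0 at k = p.
gen-as-eval-S : ∀ a → a ∈ S₋ → ∀ P x → gen a (suc P) x ≡ a (suc P) + eval (suc P) (S a (suc P)) x
gen-as-eval-S a a∈S₋ P x = begin
  a (suc P) * 1ℚ + ∑[ i ≤ P ] f (toℕ i)              ≡⟨ cong (λ s → a (suc P) * 1ℚ + s) (sum-last P f) ⟩
  a (suc P) * 1ℚ + (∑[ i < P ] f (toℕ i) + f P)      ≡⟨ cong₂ (λ s t → a (suc P) * 1ℚ + (s + t)) (eval-S a P x) (sym last-zero) ⟨
  a (suc P) * 1ℚ + (eval (suc P) (S a (suc P)) x + 0ℚ)   ≡⟨ alg (a (suc P)) (eval (suc P) (S a (suc P)) x) ⟩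
  a (suc P) + eval (suc P) (S a (suc P)) x           ∎
  where
  f : ℕ → ℚ
  f i = a (P ∸ i) * R (suc i) x
  last-zero : f P ≡ 0ℚ
  last-zero = trans (cong (_* R (suc P) x) (trans (cong a (ℕ.n∸n≡0 P)) (S₋⇒a0≡0 a a∈S₋)))
    (ℚ.*-zeroˡ (R (suc P) x))
  alg : ∀ u e → u * 1ℚ + (e + 0ℚ) ≡ u + e
  alg = solve-∀ ℚ-ring

sgn-odd : ∀ n → ¬ (2 ∣ n) → sgn n ≡ - 1ℚ
sgn-odd zero          odd = ⊥-elim (odd (2 ∣0))
sgn-odd (suc zero)    odd = refl
sgn-odd (suc (suc n)) odd = cong (-_ ∘ -_) (sgn-odd n λ 2∣n → odd (∣m∣n⇒∣m+n ∣-refl 2∣n))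

-- For odd p the sign in `gen-reflect` is +1, and a(p) cancels. From index p on both sequences
-- vanish, so they agree at every k.
S-reflected : ∀ a → a ∈ S₋ → ∀ p → ¬ (2 ∣ p) → ∀ k → S a p k ≡ reflected p (S a p) (ι p) k
S-reflected a a∈S₋ zero    p-odd k = ⊥-elim (p-odd (2 ∣0))
S-reflected a a∈S₋ p@(suc P) p-odd k = [ above , below ]′ (ℕ.≤-<-connex p k)
  where
  f = S a p
  below : k < p → f k ≡ reflected p f (ι p) k
  below = equal-on-ℕ⇒equal p f (reflected p f (ι p)) (λ m → trans (symmetric (ι m)) (sym (eval-reflected p f (ι p) (ι m)))) k
    where
    gen-symmetric : ∀ x → gen a p x ≡ gen a p (- x - ι p)
    gen-symmetric x = trans (gen-reflect a a∈S₋ p x)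
      (trans (cong (λ s → - s * gen a p (- x - ι p)) (sgn-odd p p-odd)) (ℚ.*-identityˡ (gen a p (- x - ι p))))
    symmetric : ∀ x → eval p f x ≡ eval p f (- x - ι p)
    symmetric x = ∙-cancelˡ (a p) _ _ (trans (sym (gen-as-eval-S a a∈S₋ P x))
      (trans (gen-symmetric x) (gen-as-eval-S a a∈S₋ P (- x - ι p))))
  above : p ≤ k → f k ≡ reflected p f (ι p) k
  above p≤k = trans (S-vanish a p k p≤k) (sym (reflected-vanish p f (ι p) k p≤k))

-- p-integrality

*-denominator : ∀ x → x * ι (↧ₙ x) ≡ ζ (↥ x)
*-denominator x@(mkℚ n d-1 _) = begin
  x * ι (suc d-1)                        ≡⟨ cong (_* ι (suc d-1)) (ℚ.↥p/↧p≡p x) ⟨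
  n / suc d-1 * ι (suc d-1)              ≡⟨ cong (_* ι (suc d-1)) (/-as-* n d-1) ⟩
  ζ n * inv (suc d-1) * ι (suc d-1)      ≡⟨ alg (ζ n) (inv (suc d-1)) (ι (suc d-1)) ⟩
  ζ n * (ι (suc d-1) * inv (suc d-1))    ≡⟨ cong (ζ n *_) (ι*inv d-1) ⟩
  ζ n * 1ℚ                               ≡⟨ ℚ.*-identityʳ (ζ n) ⟩
  ζ n                                    ∎
  where
  alg : ∀ n v i → n * v * i ≡ n * (i * v)
  alg = solve-∀ ℚ-ring

-- With x = m/e in lowest terms, m d = n e and e is coprime to m, so e divides d. Integrality can
-- thus be certified by any denominator prime to p, reduced or not.
denominator-∣ : ∀ x d n → x * ι d ≡ ζ n → ↧ₙ x ∣ d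
denominator-∣ x@(mkℚ m e-1 m⊥e) d n eq = Coprime.coprime-divisor (Coprime.sym (Coprime.recompute m⊥e))
  (divides ℤ.∣ n ∣ (begin
    ℤ.∣ m ∣ ℕ.* d          ≡⟨ ℤ.abs-* m (+ d) ⟨
    ℤ.∣ m ℤ.* + d ∣        ≡⟨ cong ℤ.∣_∣ cross ⟩
    ℤ.∣ n ℤ.* + suc e-1 ∣  ≡⟨ ℤ.abs-* n (+ suc e-1) ⟩
    ℤ.∣ n ∣ ℕ.* suc e-1    ∎))
  where
  unnormalised : mkℚᵘ m e-1 ℚᵘ.* mkℚᵘ (+ d) 0 ℚᵘ.≃ mkℚᵘ n 0
  unnormalised = ℚᵘ.≃-trans (ℚᵘ.*-congˡ {mkℚᵘ m e-1} (ℚᵘ.≃-sym (toℚᵘ-/ (+ d) 0)))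
    (ℚᵘ.≃-trans (ℚᵘ.≃-sym (ℚ.toℚᵘ-homo-* x (ι d)))
    (ℚᵘ.≃-trans (ℚᵘ.≃-reflexive (cong toℚᵘ eq)) (toℚᵘ-/ n 0)))
  cross : m ℤ.* + d ≡ n ℤ.* + suc e-1
  cross with unnormalised
  ... | *≡* h = trans (sym (ℤ.*-identityʳ (m ℤ.* + d))) (trans h (cong (λ k → n ℤ.* + suc k) (ℕ.*-identityʳ e-1)))

-- Integral p x unfolds to a negation from which x cannot be inferred; the record makes it rigid.
record IsIntegral (p : ℕ) (x : ℚ) : Set where
  field
    integral : Integral p x

open IsIntegral

<pred⇒suc< : ∀ {m n} → m < pred n → suc m < n
<pred⇒suc< {n = suc _} = s≤s

module _ {p : ℕ} (p-prime : Prime p) where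

  integral-by : ∀ {x} d n → ¬ (p ∣ d) → x * ι d ≡ ζ n → IsIntegral p x
  integral-by {x} d n p∤d eq .integral p∣↧x = p∤d (∣-trans p∣↧x (denominator-∣ x d n eq))

  ∤-* : ∀ {d e} → ¬ (p ∣ d) → ¬ (p ∣ e) → ¬ (p ∣ d ℕ.* e)
  ∤-* {d} {e} p∤d p∤e p∣de = [ p∤d , p∤e ]′ (euclidsLemma d e p-prime p∣de)

  1<p : 1 < p
  1<p = ℕ.nonTrivial⇒n>1 p {{prime⇒nonTrivial p-prime}}

  -- The product of the two denominators serves for sums and products, and Euclid's lemma keeps it
  -- prime to p.
  integral-isSubring : IsSubring (IsIntegral p)
  integral-isSubring = record
    { ι∈ = λ n → integral-by {ι n} 1 (+ n) (>⇒∤ 1<p) (ℚ.*-identityʳ (ι n))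
    ; +∈ = λ {x} {y} x∈ y∈ → integral-by (↧ₙ x ℕ.* ↧ₙ y) (↥ x ℤ.* ↧ y ℤ.+ ↥ y ℤ.* ↧ x) (∤-* (x∈ .integral) (y∈ .integral)) (begin
        (x + y) * ι (↧ₙ x ℕ.* ↧ₙ y)                          ≡⟨ cong ((x + y) *_) (ι-homo-* (↧ₙ x) (↧ₙ y)) ⟩
        (x + y) * (ι (↧ₙ x) * ι (↧ₙ y))                      ≡⟨ alg₊ x y (ι (↧ₙ x)) (ι (↧ₙ y)) ⟩
        x * ι (↧ₙ x) * ι (↧ₙ y) + y * ι (↧ₙ y) * ι (↧ₙ x)    ≡⟨ cong₂ (λ u v → u * ι (↧ₙ y) + v * ι (↧ₙ x)) (*-denominator x) (*-denominator y) ⟩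
        ζ (↥ x) * ζ (↧ y) + ζ (↥ y) * ζ (↧ x)                ≡⟨ cong₂ _+_ (ζ-homo-* (↥ x) (↧ y)) (ζ-homo-* (↥ y) (↧ x)) ⟨
        ζ (↥ x ℤ.* ↧ y) + ζ (↥ y ℤ.* ↧ x)                    ≡⟨ ζ-homo-+ (↥ x ℤ.* ↧ y) (↥ y ℤ.* ↧ x) ⟨
        ζ (↥ x ℤ.* ↧ y ℤ.+ ↥ y ℤ.* ↧ x)                      ∎)
    ; *∈ = λ {x} {y} x∈ y∈ → integral-by (↧ₙ x ℕ.* ↧ₙ y) (↥ x ℤ.* ↥ y) (∤-* (x∈ .integral) (y∈ .integral)) (begin
        x * y * ι (↧ₙ x ℕ.* ↧ₙ y)            ≡⟨ cong (x * y *_) (ι-homo-* (↧ₙ x) (↧ₙ y)) ⟩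
        x * y * (ι (↧ₙ x) * ι (↧ₙ y))        ≡⟨ alg* x y (ι (↧ₙ x)) (ι (↧ₙ y)) ⟩
        x * ι (↧ₙ x) * (y * ι (↧ₙ y))        ≡⟨ cong₂ _*_ (*-denominator x) (*-denominator y) ⟩
        ζ (↥ x) * ζ (↥ y)                    ≡⟨ ζ-homo-* (↥ x) (↥ y) ⟨
        ζ (↥ x ℤ.* ↥ y)                      ∎)
    ; -∈ = λ {x} x∈ → record { integral = subst (λ d → ¬ (p ∣ ℤ.∣ d ∣)) (sym (ℚ.↧-neg x)) (x∈ .integral) }
    }
    where
    alg₊ : ∀ x y d e → (x + y) * (d * e) ≡ x * d * e + y * e * d
    alg₊ = solve-∀ ℚ-ring
    alg* : ∀ x y d e → x * y * (d * e) ≡ x * d * (y * e)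
    alg* = solve-∀ ℚ-ring

  open IsSubring integral-isSubring

  inv-integral : ∀ {k} → suc k < p → IsIntegral p (inv (suc k))
  inv-integral {k} k<p = integral-by (suc k) (+ 1) (>⇒∤ k<p)
    (trans (ℚ.*-comm (inv (suc k)) (ι (suc k))) (ι*inv k))

  ∑-integral : ∀ n {f : ℕ → ℚ} → (∀ k → k < n → IsIntegral p (f k)) → IsIntegral p (∑[ i < n ] f (toℕ i))
  ∑-integral zero    f∈ = ι∈ 0
  ∑-integral (suc n) f∈ = +∈ (f∈ 0 (s≤s z≤n)) (∑-integral n λ k k<n → f∈ (suc k) (s≤s k<n))

  E-integral : ∀ n {b} → b ≤ p → IsIntegral p (E n b)
  E-integral zero    b≤p = ι∈ 1
  E-integral (suc n) {b} b≤p = subst (IsIntegral p) (sym (E-suc n b)) (∑-integral (pred b) λ i i<b-1 →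
    let 1+i<p = ℕ.<-≤-trans (<pred⇒suc< i<b-1) b≤p in
    *∈ (inv-integral 1+i<p) (E-integral n (ℕ.<⇒≤ 1+i<p)))

  -- Every index k satisfies 0 < k < p, so 1/k is p-integral and p - k lies in the range where `a`
  -- is.
  S-integral : ∀ a → (∀ k → k < p → Integral p (a k)) → ∀ k → IsIntegral p (S a p k)
  S-integral a a∈ zero    = ι∈ 0
  S-integral a a∈ (suc m) = subst (IsIntegral p) (sym (S-suc a p m)) (∑-integral (pred p) λ i i<p-1 →
    let 1+i<p = <pred⇒suc< i<p-1 in
    *∈ (*∈ (a∈′ (ℕ.∸-monoʳ-< (s≤s z≤n) (ℕ.<⇒≤ 1+i<p))) (inv-integral 1+i<p)) (E-integral m (ℕ.<⇒≤ 1+i<p)))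
    where
    a∈′ : ∀ {k} → k < p → IsIntegral p (a k)
    a∈′ {k} k<p .integral = a∈ k k<p

  2∤p : 2 < p → ¬ (2 ∣ p)
  2∤p 2<p 2∣p with prime⇒irreducible p-prime 2∣p
  ... | inj₂ refl = ℕ.<-irrefl refl 2<p

  -- For odd k the leading term on the reflected side is minus S at k, hence the factor 2; for even
  -- k the leading terms would cancel.
  S-expand : ∀ a → a ∈ S₋ → 2 < p → (∀ k → k < p → Integral p (a k)) →
    ∀ k → ¬ (2 ∣ k) → ∃[ z ] IsIntegral p z × ι 2 * S a p k ≡
      ι (suc k) * ι p * S a p (suc k) - ι p * ι p * (tri k * S a p (2 ℕ.+ k) + ι p * z)
  S-expand a a∈S₋ 2<p a∈ k k-odd =
    let z , z∈ , eq = reflected-expand integral-isSubring p f (ι∈ p) (S-integral a a∈) (S-vanish a p) k in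
    z , z∈ , (begin
      ι 2 * f k                          ≡⟨ alg₁ (f k) ⟩
      f k + f k                          ≡⟨ cong (λ u → f k + u) (trans (S-reflected a a∈S₋ p (2∤p 2<p) k) eq) ⟩
      f k + sgn k * (f k - ι (suc k) * ι p * f (suc k) + ι p * ι p * (tri k * f (2 ℕ.+ k) + ι p * z))
        ≡⟨ cong (λ s → f k + s * (f k - ι (suc k) * ι p * f (suc k) + ι p * ι p * (tri k * f (2 ℕ.+ k) + ι p * z))) (sgn-odd k k-odd) ⟩
      f k + - 1ℚ * (f k - ι (suc k) * ι p * f (suc k) + ι p * ι p * (tri k * f (2 ℕ.+ k) + ι p * z))
        ≡⟨ alg₂ (f k) (ι (suc k) * ι p * f (suc k)) (ι p * ι p * (tri k * f (2 ℕ.+ k) + ι p * z)) ⟩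
      ι (suc k) * ι p * f (suc k) - ι p * ι p * (tri k * f (2 ℕ.+ k) + ι p * z) ∎)
    where
    f = S a p
    alg₁ : ∀ u → (1ℚ + 1ℚ) * u ≡ u + u
    alg₁ = solve-∀ ℚ-ring
    alg₂ : ∀ u v w → u + - 1ℚ * (u - v + w) ≡ v - w
    alg₂ = solve-∀ ℚ-ring

theorem1p1 : (a : ℕ → ℚ) → a ∈ S₋ →
    (n : ℕ) → .{{_ : NonZero n}} → ¬ (2 ∣ n) →
    (p : ℕ) → Prime p → suc n < p →
    (∀ k → k < p → Integral p (a k)) →
    multiSum a p n ≡ (+ (p ℕ.* suc n) / 2) * multiSum a p (suc n) [mod p ^ 3 ]
theorem1p1 a a∈S₋ n@(suc _) n-odd p p-prime 1+n<p a∈ =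
  -- With S at n + 2 equal to `q * y`, the second-order term and the remainder of the expansion at n
  -- both carry p³; `h` = 1/2 comes from solving for `f n`.
  - (h * (tri n * y + z)) , -∈ (*∈ h∈ (+∈ (*∈ (tri∈ sub n) y∈) z∈)) .integral , (begin
    f n - (+ (p ℕ.* suc n) / 2) * f (suc n)
      ≡⟨ cong (λ c → f n - c * f (suc n)) (trans (/-as-* (+ (p ℕ.* suc n)) 1) (cong (_* h) (ι-homo-* p (suc n)))) ⟩
    f n - q * ι (suc n) * h * f (suc n)
      ≡⟨ cong (_- q * ι (suc n) * h * f (suc n)) (half (f n)) ⟩
    h * (ι 2 * f n) - q * ι (suc n) * h * f (suc n)
      ≡⟨ cong (λ u → h * u - q * ι (suc n) * h * f (suc n)) eq ⟩
    h * (ι (suc n) * q * f (suc n) - q * q * (tri n * f (2 ℕ.+ n) + q * z)) - q * ι (suc n) * h * f (suc n)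
      ≡⟨ alg₁ h (ι (suc n)) q (f (suc n)) (tri n * f (2 ℕ.+ n)) z ⟩
    - (h * (q * q * (tri n * f (2 ℕ.+ n) + q * z)))
      ≡⟨ cong (λ u → - (h * (q * q * (tri n * u + q * z)))) f[n+2] ⟩
    - (h * (q * q * (tri n * (q * y) + q * z)))
      ≡⟨ alg₂ h q (tri n) y z ⟩
    q * (q * (q * 1ℚ)) * - (h * (tri n * y + z))
      ≡⟨ cong (_* - (h * (tri n * y + z))) p^3 ⟨
    ι (p ℕ.^ 3) * - (h * (tri n * y + z)) ∎)
  where
  sub = integral-isSubring p-prime
  open IsSubring sub
  f = S a p
  q = ι p
  h = inv 2
  2<p : 2 < p
  -- `n` is a successor, so 2 ≤ n + 1; the bound makes p odd and 2 invertible in ℤ₍ₚ₎.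
  2<p = ℕ.≤-<-trans (s≤s (s≤s z≤n)) 1+n<p
  h∈ : IsIntegral p h
  h∈ = inv-integral p-prime 2<p
  f∈ : ∀ k → IsIntegral p (f k)
  f∈ = S-integral p-prime a a∈
  expand : ∀ k → ¬ (2 ∣ k) → ∃[ z ] IsIntegral p z × ι 2 * f k ≡
    ι (suc k) * q * f (suc k) - q * q * (tri k * f (2 ℕ.+ k) + q * z)
  expand = S-expand p-prime a a∈S₋ 2<p a∈
  z = proj₁ (expand n n-odd)
  z∈ = proj₁ (proj₂ (expand n n-odd))
  eq = proj₂ (proj₂ (expand n n-odd))
  2+n-odd : ¬ (2 ∣ 2 ℕ.+ n)
  2+n-odd 2∣2+n = n-odd (∣m+n∣m⇒∣n 2∣2+n ∣-refl)
  w = proj₁ (expand (2 ℕ.+ n) 2+n-odd)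
  w∈ = proj₁ (proj₂ (expand (2 ℕ.+ n) 2+n-odd))
  -- The expansion at the odd index n + 2, halved and with one factor p taken out of each of its
  -- terms.
  y = h * (ι (3 ℕ.+ n) * f (3 ℕ.+ n) - q * (tri (2 ℕ.+ n) * f (4 ℕ.+ n) + q * w))
  y∈ : IsIntegral p y
  y∈ = *∈ h∈ (+∈ (*∈ (ι∈ (3 ℕ.+ n)) (f∈ (3 ℕ.+ n)))
    (-∈ (*∈ (ι∈ p) (+∈ (*∈ (tri∈ sub (2 ℕ.+ n)) (f∈ (4 ℕ.+ n))) (*∈ (ι∈ p) w∈)))))
  half : ∀ u → u ≡ h * (ι 2 * u)
  half u = trans (sym (ℚ.*-identityˡ u)) (ℚ.*-assoc h (ι 2) u)
  f[n+2] : f (2 ℕ.+ n) ≡ q * y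
  f[n+2] = trans (half (f (2 ℕ.+ n)))
    (trans (cong (h *_) (proj₂ (proj₂ (expand (2 ℕ.+ n) 2+n-odd))))
      (alg h (ι (3 ℕ.+ n)) q (f (3 ℕ.+ n)) (tri (2 ℕ.+ n) * f (4 ℕ.+ n) + q * w)))
    where
    alg : ∀ h i q u v → h * (i * q * u - q * q * v) ≡ q * (h * (i * u - q * v))
    alg = solve-∀ ℚ-ring
  p^3 : ι (p ℕ.^ 3) ≡ q * (q * (q * 1ℚ))
  p^3 = trans (ι-homo-* p (p ℕ.^ 2)) (cong (q *_) (trans (ι-homo-* p (p ℕ.^ 1)) (cong (q *_) (ι-homo-* p 1))))
  alg₁ : ∀ h i q u v z → h * (i * q * u - q * q * (v + q * z)) - q * i * h * u ≡ - (h * (q * q * (v + q * z)))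
  alg₁ = solve-∀ ℚ-ring
  alg₂ : ∀ h q t y z → - (h * (q * q * (t * (q * y) + q * z))) ≡ q * (q * (q * 1ℚ)) * - (h * (t * y + z))
  alg₂ = solve-∀ ℚ-ring
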